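{- For infinitely many odd composite integers $N$, the algorithm GP (described in the context), run on input $N$, finds a prime divisor of $N$, i.e. it terminates with an output $\gcd(D,N)$ that is a prime divisor of $N$, in time at most $O(\ln^{2} N)$. That is, there are an absolute constant $C$ and infinitely many odd composite $N$ such that on input $N$ the algorithm outputs a prime divisor of $N$ with total cost at most $C(\ln N)^2$.
   Context: Here $\ln$ denotes the logarithm to base $2$. For a positive integer $N$, a pair $(a,b)$ of positive integers is a graph pair for $N$ if $ab\equiv 1 \pmod N$. For an integer $x$, "$x \,(\mathrm{mod}\ N)$" used as a number denotes the remainder of $x$ on division by $N$. Algorithm GP, with input an odd integer $N>1$: 1. Let $j=0$. 2. Put $j=j+1$. 3. If $(N-1)/2^{j}$ is an integer, take the pair $((N-1)/a,\ N-a)$ with $a=(N-1)/2^{j}$. 4. Otherwise take the pair $(2^{j-1}\cdot 2,\ (b_{j-1}b_1)\,(\mathrm{mod}\ N))$. 5. Denote the pair obtained by $(2^{j},b_j)$. 6. Compute $D=|b_j-2^{j}|$. 7. If $2^{j}<N$, go to step 8; otherwise stop (with no output). 8. If $\gcd(D,N)=1$, go to step 2; otherwise print "$N$ is composite", print $\gcd(D,N)$ and $j$, and stop. Cost model: the running time is measured by the computations of $\gcd(D,N)$; each such computation costs $O(\ln N)$, so the total cost is $O(j\ln N)$, where $j$ is the number of iterations performed. -}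

module Defs where

open import Data.Nat using (ℕ; zero; suc; _+_; _*_; _∸_; _^_; _≤_; _<_; NonZero; ∣_-_∣; _/_; _%_)
open import Data.Nat.Divisibility using (_∣_; _∤_)
open import Data.Nat.GCD using (gcd)
open import Data.Nat.Logarithm using (⌊log₂_⌋)
open import Data.Product using (_×_; _,_)
open import Relation.Binary.PropositionalEquality using (_≡_; _≢_)

-- Pair N j (x , y): the pair that steps 3-5 of GP attach to the index j,
-- afterwards denoted (2 ^ j , b_j).
data Pair (N : ℕ) : ℕ → ℕ × ℕ → Set where
  -- The equation says that (N - 1) / 2 ^ j is an integer, equal to a.
  step3 : ∀ {j a} .{{_ : NonZero a}} →
          N ∸ 1 ≡ a * 2 ^ j →
          Pair N j ((N ∸ 1) / a , N ∸ a)
  -- For odd N the index suc j here is never 1, since 2 ∣ N - 1.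
  step4 : ∀ {j x₁ b₁ x b} .{{_ : NonZero N}} →
          2 ^ suc j ∤ N ∸ 1 →
          Pair N 1 (x₁ , b₁) →
          Pair N j (x , b) →
          Pair N (suc j) (2 ^ j * 2 , (b * b₁) % N)

data Output : Set where
  noOutput  : Output
  composite : (d j : ℕ) → Output

-- Runs of GP on input N, where gcdCost D N is the cost of computing gcd(D,N).
-- Loop j out t: entering step 2 with counter j, GP stops with result out, and
-- the gcd computations made from then on cost t in total.
module _ (gcdCost : ℕ → ℕ → ℕ) (N : ℕ) where

  data Loop (j : ℕ) : Output → ℕ → Set where
    stop  : ∀ {x b} →
            Pair N (suc j) (x , b) →
            N ≤ 2 ^ suc j →
            Loop j noOutput 0
    print : ∀ {x b} →
            Pair N (suc j) (x , b) →
            2 ^ suc j < N →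
            let D = ∣ b - 2 ^ suc j ∣ in
            gcd D N ≢ 1 →
            Loop j (composite (gcd D N) (suc j)) (gcdCost D N)
    again : ∀ {x b out t} →
            Pair N (suc j) (x , b) →
            2 ^ suc j < N →
            let D = ∣ b - 2 ^ suc j ∣ in
            gcd D N ≡ 1 →
            Loop (suc j) out t →
            Loop j out (gcdCost D N + t)

  GP : Output → ℕ → Set
  GP = Loop 0

-- Each gcd computation costs O(log N), with constant c.  In GP always D < N.
-- For N > 1, ⌊log₂ N⌋ ≤ log₂ N ≤ 2 ⌊log₂ N⌋, so rounding the logarithm down
-- changes such a bound by a constant factor only.
LogCost : ℕ → (ℕ → ℕ → ℕ) → Set
LogCost c gcdCost = ∀ D N → 1 < N → D < N → gcdCost D N ≤ c * ⌊log₂ N ⌋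

{-# OPTIONS --safe #-}

-- Run GP on N = 3 (2 k + 1).  The first pair is (2 , (N + 1) / 2), so the first
-- gcd computed is that of D = (N + 1) / 2 - 2 = 3 k with N, which is
-- 3 gcd(k , 2 k + 1) = 3.  GP therefore prints the prime 3 at j = 1, after a
-- single gcd computation.
module Submission where

open import Defs
open import Data.Nat
  using (ℕ; suc; s≤s; NonZero; >-nonZero⁻¹; >-nonZero; _+_; _∸_; _*_; _^_; _≤_; _<_; ∣_-_∣)
open import Data.Nat.Divisibility
  using (_∣_; _∤_; >⇒∤; ∣-trans; ∣-antisym; ∣m+n∣m⇒∣n; m∣m*n; n∣m*n)
open import Data.Nat.GCD using (gcd; gcd-greatest; gcd[m,n]∣m; gcd[m,n]∣n)
open import Data.Nat.Logarithm using (⌊log₂_⌋; ⌊log₂⌋-mono-≤)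
open import Data.Nat.Primality using (Prime; Composite; composite-≢; prime?)
open import Data.Nat.Properties
  using (+-comm; m+n∸m≡n; m≤n*m; m≤n+m; m≤m*n; m≤m+n; n<1+n; ≤-trans; <⇒≤; <⇒≢; *-monoʳ-≤;
         *-monoʳ-<; ∣-∣-identityʳ)
open import Data.Nat.Tactic.RingSolver using (solve-∀)
open import Data.Product using (_×_; _,_; ∃-syntax)
open import Function using (case_of_)
open import Relation.Binary.PropositionalEquality
  using (_≡_; sym; trans; cong; subst)
open import Relation.Nullary.Decidable using (from-yes)

module _ (k : ℕ) .{{_ : NonZero k}} where

  private
    -- `a` is (N - 1) / 2, the quotient taken by step 3 at j = 1; `N ∸ a` is then b_1, and `D` is
    -- the number formed in step 6.
    N a D : ℕ
    N = 3 * (1 + 2 * k)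
    a = 1 + 3 * k
    D = ∣ N ∸ a - 2 ∣

    N≡a+[2+3k] : N ≡ a + (2 + 3 * k)
    N≡a+[2+3k] = eq k
      where
      eq : ∀ x → 3 * (1 + 2 * x) ≡ (1 + 3 * x) + (2 + 3 * x)
      eq = solve-∀

    N≡3k*2+3 : N ≡ 3 * k * 2 + 3
    N≡3k*2+3 = eq k
      where
      eq : ∀ x → 3 * (1 + 2 * x) ≡ 3 * x * 2 + 3
      eq = solve-∀

    N≡a*2+1 : N ≡ a * 2 + 1
    N≡a*2+1 = eq k
      where
      eq : ∀ x → 3 * (1 + 2 * x) ≡ (1 + 3 * x) * 2 + 1
      eq = solve-∀

    N∸1≡a*2 : N ∸ 1 ≡ a * 2
    N∸1≡a*2 = cong (_∸ 1) (trans N≡a*2+1 (+-comm (a * 2) 1))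

    D≡3k : D ≡ 3 * k
    D≡3k = trans (cong (λ n → ∣ n ∸ a - 2 ∣) N≡a+[2+3k])
          (trans (cong (λ b → ∣ b - 2 ∣) (m+n∸m≡n a (2 + 3 * k)))
                 -- `∣ 2 + 3 * k - 2 ∣` reduces to `∣ 3 * k - 0 ∣` by computation.
                 (∣-∣-identityʳ (3 * k)))

    D<N : D < N
    D<N = subst (_< N) (sym D≡3k)
            (*-monoʳ-< 3 (s≤s (m≤m+n k (k + 0))))

    gcd≡3 : gcd D N ≡ 3
    gcd≡3 = trans (cong (λ d → gcd d N) D≡3k)
                  (∣-antisym g∣3 (gcd-greatest (m∣m*n k) (m∣m*n (1 + 2 * k))))
      where
      g∣3 : gcd (3 * k) N ∣ 3
      -- The gcd divides both `3 * k * 2` and `3 * k * 2 + 3`, hence their difference.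
      g∣3 = ∣m+n∣m⇒∣n (subst (gcd (3 * k) N ∣_) N≡3k*2+3 (gcd[m,n]∣n (3 * k) N))
                       (∣-trans (gcd[m,n]∣m (3 * k) N) (m∣m*n 2))

    -- Positivity of `k` enters here: at `k = 0` the number `N` would be 3 itself. Strictness makes
    -- 3 a proper divisor, whence `N` is composite.
    3<N : 3 < N
    3<N = *-monoʳ-< 3 {1} {1 + 2 * k} (s≤s (≤-trans (>-nonZero⁻¹ k) (m≤m+n k (k + 0))))

    2<N : 2 < N
    2<N = <⇒≤ 3<N

    1<N : 1 < N
    1<N = <⇒≤ 2<N

  2∤3[1+2k] : 2 ∤ 3 * (1 + 2 * k)
  2∤3[1+2k] 2∣N =
    >⇒∤ (n<1+n 1) (∣m+n∣m⇒∣n (subst (2 ∣_) N≡a*2+1 2∣N) (n∣m*n a))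

  composite-3[1+2k] : Composite (3 * (1 + 2 * k))
  composite-3[1+2k] = composite-≢ 3 (<⇒≢ 3<N) (m∣m*n (1 + 2 * k))

  GP-prints-prime : ∀ c {gcdCost} → LogCost c gcdCost →
    ∃[ p ] ∃[ j ] ∃[ t ]
      (GP gcdCost (3 * (1 + 2 * k)) (composite p j) t × Prime p × p ∣ 3 * (1 + 2 * k) ×
       t ≤ c * ⌊log₂ (3 * (1 + 2 * k)) ⌋ ^ 2)
  GP-prints-prime c {gcdCost} cost =
      gcd D N , 1 , gcdCost D N
    , print (step3 {a = a} N∸1≡a*2) 2<N (λ gcd≡1 → case trans (sym gcd≡3) gcd≡1 of λ ())
    , subst Prime (sym gcd≡3) (from-yes (prime? 3))
    , gcd[m,n]∣n D N
    -- The single gcd costs at most `c * L`, so `c` itself serves as the final constant once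
    -- `L ≤ L ^ 2`.
    , ≤-trans (cost D N 1<N D<N) (*-monoʳ-≤ c L≤L^2)
    where
    L = ⌊log₂ N ⌋
    1≤L : 1 ≤ L
    -- `1<N` unfolds to `2 ≤ N`, and `⌊log₂ 2 ⌋` evaluates to 1.
    1≤L = ⌊log₂⌋-mono-≤ {2} 1<N
    L≤L^2 : L ≤ L ^ 2
    -- `L ^ 2` unfolds to `L * (L * 1)`, whose second factor has to be nonzero.
    L≤L^2 = m≤m*n L (L * 1) {{>-nonZero (≤-trans 1≤L (m≤m*n L 1))}}

mainTheorem1 : ∀ (c : ℕ) → ∃[ C ] (∀ (gcdCost : ℕ → ℕ → ℕ) → LogCost c gcdCost →
    ∀ (m : ℕ) → ∃[ N ] (m < N × 2 ∤ N × Composite N ×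
    (∃[ p ] ∃[ j ] ∃[ t ]
    (GP gcdCost N (composite p j) t × Prime p × p ∣ N × t ≤ C * ⌊log₂ N ⌋ ^ 2))))
mainTheorem1 c = c , λ gcdCost cost m →
  -- The successor makes `k` nonzero and turns `m < N` into `k ≤ N`.
  let k = suc m in
    3 * (1 + 2 * k)
  , ≤-trans (m≤m+n k (k + 0)) (≤-trans (m≤n+m (2 * k) 1) (m≤n*m (1 + 2 * k) 3))
  , 2∤3[1+2k] k
  , composite-3[1+2k] k
  , GP-prints-prime k c cost
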